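{- Let $\star\in\{\boxtimes,\circ\}$, $k$ a positive integer, and $G,H$ graphs. The following are equivalent: (1) $m_k(G\star H)$ is $\circledast$-well-behaved w.r.t. $G$ and $H$; (2) there exist $M_G\subseteq E_G$ and $M_H\subseteq E_H$ satisfying one of the conditions (M1)–(M4) below such that $u_k(G\star H)=u_Gu_H$, where $u_G,u_H$ are the numbers of $M_G$-unmatched vertices of $G$ and $M_H$-unmatched vertices of $H$. Conditions: (M1)(a) $M_G$ is a perfect $k$-matching of $G$ and $M_H$ a non-empty $1$-matching of $H$, or (M1)(b) $M_G$ is a non-empty $k$-matching of $G$ and $M_H=\emptyset$; (M2)(a) $M_G$ is a non-empty $1$-matching of $G$ and $M_H$ a perfect $k$-matching of $H$, or (M2)(b) $M_G=\emptyset$ and $M_H$ is a non-empty $k$-matching of $H$; (M3) $k=1$ and $M_G,M_H$ are $1$-matchings of $G,H$; (M4) $M_G$ is a perfect $k_G$-matching of $G$ and $M_H$ a perfect $k_H$-matching of $H$ for positive integers $k_G,k_H$ with $k_Gk_H=k$.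
   Context: Graphs are finite, simple, undirected, with non-empty vertex set. For a positive integer $k$, a $k$-matching of $G=(V,E)$ is a set $M\subseteq E$ such that every vertex is incident to either $0$ or exactly $k$ edges of $M$; a vertex incident to no edge of $M$ is $M$-unmatched; $M$ is perfect if there are no unmatched vertices. $m_k(G)$ is the maximum size of a $k$-matching of $G$, and $u_k(G)$ is the number of vertices unmatched by a maximum $k$-matching (independent of the choice). Products on $V_G\times V_H$: in $G\boxtimes H$, $(g,h)\sim(g',h')$ iff (i) $\{g,g'\}\in E_G$, $h=h'$; or (ii) $g=g'$, $\{h,h'\}\in E_H$; or (iii) $\{g,g'\}\in E_G$ and $\{h,h'\}\in E_H$; in $G\circ H$ iff $\{g,g'\}\in E_G$ or (ii). With $U_G,U_H$ the unmatched vertex sets: $F_{\ast}(M_G,M_H)=\{\{(g,h),(g',h')\}:\{g,g'\}\in M_G,\{h,h'\}\in M_H\}$, $M^{U}_G=\{\{(u,h),(u,h')\}:u\in U_G,\{h,h'\}\in M_H\}$, $M^{U}_H=\{\{(g,u),(g',u)\}:u\in U_H,\{g,g'\}\in M_G\}$, $F_{\circledast}(M_G,M_H)=F_{\ast}(M_G,M_H)\cup M^{U}_G\cup M^{U}_H$. $m_k(G\star H)$ is $\circledast$-well-behaved w.r.t. $G$ and $H$ if $m_k(G\star H)=|F_{\circledast}(M_G,M_H)|$ for some $M_G\subseteq E_G$, $M_H\subseteq E_H$ for which $F_{\circledast}(M_G,M_H)$ is a $k$-matching of $G\star H$.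
   Formalization: For k ≥ 2 the formal theorem assumes that G⋆H has a non-empty k-matching (m_k(G⋆H) > 0); otherwise (1) holds with M_G = M_H = ∅ while (2) fails, e.g. G = H = K_1, k = 2. -}

module Defs where

open import Level using (0ℓ)
open import Data.Bool using (Bool)
open import Data.Nat using (ℕ; zero; suc; _+_; _*_; _≤_; _<_; NonZero)
open import Data.Nat.Properties using (_≟_; _<?_; m*n≢0; ≤-trans; ≤-reflexive; m≤m+n; +-suc; +-monoʳ-≤; ≮⇒≥)
open import Data.Fin using (Fin; toℕ; combine; remQuot)
open import Data.Fin.Properties using (all?; inj⇒≟; *↔×; remQuot-combine)
open import Data.Fin.Subset using (Subset; _∈_)
open import Data.Fin.Subset.Properties using (_∈?_; anySubset?)
open import Data.List using (List; []; _∷_; length; filter; map; allFin; cartesianProduct)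
open import Data.List.Properties using (filter-≐; length-filter)
open import Data.Vec using (tabulate)
open import Data.Vec.Properties using (lookup∘tabulate; lookup⇒[]=; []=⇒lookup)
open import Data.Product using (Σ-syntax; ∃-syntax; _×_; _,_; proj₁; proj₂)
open import Data.Product.Function.NonDependent.Propositional using (_×-↔_)
open import Data.Sum using (_⊎_; inj₁; inj₂; swap)
open import Data.Empty using (⊥)
open import Function using (_↔_; Inverse)
open import Function.Properties.Inverse using (↔-sym; ↔-trans; ↔⇒↣)
open import Relation.Binary using (Rel; Decidable; DecidableEquality; Symmetric)
open import Relation.Binary.PropositionalEquality using (_≡_; refl; sym; trans; cong; cong₂; subst)
open import Relation.Nullary using (¬_; Dec; yes; no; does)
open import Relation.Nullary.Decidable using (_×-dec_; _⊎-dec_; map′; dec-true)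
import Relation.Unary as Unary

record Graph : Set₁ where
  field
    Vertex   : Set
    order    : ℕ
    finite   : Vertex ↔ Fin order
    nonEmpty : NonZero order
    _∼_      : Rel Vertex 0ℓ
    _∼?_     : Decidable _∼_
    ∼-sym    : Symmetric _∼_
    ∼-irrefl : ∀ {v} → ¬ (v ∼ v)

  index : Vertex → Fin order
  index = Inverse.to finite

  vertices : List Vertex
  vertices = map (Inverse.from finite) (allFin order)

  _≟ᵥ_ : DecidableEquality Vertex
  _≟ᵥ_ = inj⇒≟ (↔⇒↣ finite)

open Graph using (Vertex)

-- A set of edges M ⊆ E, as a symmetric relation: joins u v means {u,v} ∈ M.
record EdgeSet (G : Graph) : Set₁ where
  open Graph G using (_∼_)
  field
    joins     : Rel (Vertex G) 0ℓ
    joins?    : Decidable joins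
    joins-sym : Symmetric joins
    ⊆E        : ∀ {u v} → joins u v → u ∼ v

module _ {G : Graph} (M : EdgeSet G) where
  open Graph G using (vertices; index)
  open EdgeSet M

  NonEmpty : Set
  NonEmpty = ∃[ u ] ∃[ v ] joins u v

  Empty : Set
  Empty = ∀ u v → ¬ joins u v

  -- The number of edges of M incident to v; in a simple graph these
  -- correspond to the M-neighbours of v.
  degree : Vertex G → ℕ
  degree v = length (filter (joins? v) vertices)

  -- Each edge {u,v} is counted once, as the ordered pair (u , v) with
  -- index u < index v.
  Listed : Vertex G × Vertex G → Set
  Listed (u , v) = toℕ (index u) < toℕ (index v) × joins u v

  listed? : Unary.Decidable Listed
  listed? (u , v) = (toℕ (index u) <? toℕ (index v)) ×-dec joins? u v

  size : ℕ
  size = length (filter listed? (cartesianProduct vertices vertices))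

  Unmatched : Vertex G → Set
  Unmatched v = degree v ≡ 0

  unmatched? : Unary.Decidable Unmatched
  unmatched? v = degree v ≟ 0

  unmatchedCount : ℕ
  unmatchedCount = length (filter unmatched? vertices)

IsMatching : ℕ → {G : Graph} → EdgeSet G → Set
IsMatching k M = ∀ v → degree M v ≡ 0 ⊎ degree M v ≡ k

IsPerfectMatching : ℕ → {G : Graph} → EdgeSet G → Set
IsPerfectMatching k M = IsMatching k M × (∀ v → ¬ Unmatched M v)

IsMaximumMatching : ℕ → {G : Graph} → EdgeSet G → Set₁
IsMaximumMatching k {G} M =
  IsMatching k M × ((N : EdgeSet G) → IsMatching k N → size N ≤ size M)

private
  module Search (k : ℕ) (G : Graph) where
    open Graph G hiding (Vertex)
    open EdgeSet

    code : Vertex G → Vertex G → Fin (order * order)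
    code u v = combine (index u) (index v)

    decode : Subset (order * order) → EdgeSet G
    decode s = record
      { joins     = λ u v → u ∼ v × (code u v ∈ s ⊎ code v u ∈ s)
      ; joins?    = λ u v → (u ∼? v) ×-dec ((code u v ∈? s) ⊎-dec (code v u ∈? s))
      ; joins-sym = λ (e , i) → ∼-sym e , swap i
      ; ⊆E        = proj₁
      }

    module _ (M : EdgeSet G) where
      bit : Fin order × Fin order → Bool
      bit (i , j) = does (joins? M (Inverse.from finite i) (Inverse.from finite j))

      encode : Subset (order * order)
      encode = tabulate (λ p → bit (remQuot order p))

      lookup-code : ∀ u v → bit (remQuot order (code u v)) ≡ does (joins? M u v)
      lookup-code u v = trans
        (cong bit (remQuot-combine (index u) (index v)))
        (cong₂ (λ u v → does (joins? M u v))
          (Inverse.strictlyInverseʳ finite u) (Inverse.strictlyInverseʳ finite v))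

      ∈-encode⁺ : ∀ u v → joins M u v → code u v ∈ encode
      ∈-encode⁺ u v e = lookup⇒[]= (code u v) encode
        (trans (lookup∘tabulate _ (code u v))
          (trans (lookup-code u v) (dec-true (joins? M u v) e)))

      ∈-encode⁻ : ∀ u v → code u v ∈ encode → joins M u v
      ∈-encode⁻ u v i with joins? M u v | trans (sym (lookup-code u v)) (trans (sym (lookup∘tabulate _ (code u v))) ([]=⇒lookup i))
      ... | yes e | _  = e
      ... | no _  | ()

      to : ∀ {u v} → joins (decode encode) u v → joins M u v
      to {u} {v} (_ , inj₁ i) = ∈-encode⁻ u v i
      to {u} {v} (_ , inj₂ i) = joins-sym M (∈-encode⁻ v u i)

      from : ∀ {u v} → joins M u v → joins (decode encode) u v
      from {u} {v} e = ⊆E M e , inj₁ (∈-encode⁺ u v e)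

      degree-decode : ∀ v → degree (decode encode) v ≡ degree M v
      degree-decode v = cong length
        (filter-≐ (joins? (decode encode) v) (joins? M v) (to , from) vertices)

      size-decode : size (decode encode) ≡ size M
      size-decode = cong length
        (filter-≐ (listed? (decode encode)) (listed? M)
          ((λ (l , e) → l , to e) , (λ (l , e) → l , from e))
          (cartesianProduct vertices vertices))

      matching-decode : IsMatching k M → IsMatching k (decode encode)
      matching-decode m v rewrite degree-decode v = m v

    isMatching? : (M : EdgeSet G) → Dec (IsMatching k M)
    isMatching? M = map′
      (λ f v → subst P (Inverse.strictlyInverseʳ finite v) (f (index v)))
      (λ f i → f (Inverse.from finite i))
      (all? (λ i → let v = Inverse.from finite i in
        (degree M v ≟ 0) ⊎-dec (degree M v ≟ k)))
      where
      P : Vertex G → Set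
      P v = degree M v ≡ 0 ⊎ degree M v ≡ k

    bound : ℕ
    bound = length (cartesianProduct vertices vertices)

    size≤bound : (M : EdgeSet G) → size M ≤ bound
    size≤bound M = length-filter (listed? M) (cartesianProduct vertices vertices)

    improve : ∀ fuel (M : EdgeSet G) → IsMatching k M → bound ≤ fuel + size M →
              Σ[ M ∈ EdgeSet G ] IsMaximumMatching k M
    improve zero M m b = M , m , λ N _ → ≤-trans (size≤bound N) b
    improve (suc fuel) M m b
      with anySubset? (λ s → isMatching? (decode s) ×-dec (size M <? size (decode s)))
    ... | yes (s , m′ , lt) = improve fuel (decode s) m′
            (≤-trans b (≤-trans (≤-reflexive (sym (+-suc fuel (size M)))) (+-monoʳ-≤ fuel lt)))
    ... | no ¬larger = M , m , λ N n → ≮⇒≥ λ lt →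
            ¬larger (encode N , matching-decode N n ,
                     subst (size M <_) (sym (size-decode N)) lt)

    ∅ : EdgeSet G
    ∅ = record
      { joins     = λ _ _ → ⊥
      ; joins?    = λ _ _ → no λ ()
      ; joins-sym = λ ()
      ; ⊆E        = λ ()
      }

    ∅-matching : IsMatching k ∅
    ∅-matching v = inj₁ (none vertices)
      where
      none : ∀ vs → length (filter (joins? ∅ v) vs) ≡ 0
      none []       = refl
      none (_ ∷ vs) = none vs

maximumMatching : ∀ k (G : Graph) → Σ[ M ∈ EdgeSet G ] IsMaximumMatching k M
maximumMatching k G = improve bound ∅ ∅-matching (m≤m+n bound _)
  where open Search k G

matchingNumber : ℕ → Graph → ℕ
matchingNumber k G = size (proj₁ (maximumMatching k G))

-- All maximum k-matchings leave the same number of vertices unmatched, by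
-- 2 |M| = k (|V| - number of unmatched vertices), so the choice is immaterial
-- for k > 0.
unmatchedNumber : ℕ → Graph → ℕ
unmatchedNumber k G = unmatchedCount (proj₁ (maximumMatching k G))

data Product : Set where
  strong lexicographic : Product

module _ (G H : Graph) where
  private
    module G = Graph G
    module H = Graph H

  Adjacent : Product → Rel (Vertex G × Vertex H) 0ℓ
  Adjacent strong (g , h) (g′ , h′) =
    (g G.∼ g′ × h ≡ h′) ⊎ (g ≡ g′ × h H.∼ h′) ⊎ (g G.∼ g′ × h H.∼ h′)
  Adjacent lexicographic (g , h) (g′ , h′) =
    g G.∼ g′ ⊎ (g ≡ g′ × h H.∼ h′)

  private
    adjacent? : ∀ ⋆ → Decidable (Adjacent ⋆)
    adjacent? strong (g , h) (g′ , h′) =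
      ((g G.∼? g′) ×-dec (h H.≟ᵥ h′)) ⊎-dec
      (((g G.≟ᵥ g′) ×-dec (h H.∼? h′)) ⊎-dec ((g G.∼? g′) ×-dec (h H.∼? h′)))
    adjacent? lexicographic (g , h) (g′ , h′) =
      (g G.∼? g′) ⊎-dec ((g G.≟ᵥ g′) ×-dec (h H.∼? h′))

    adjacent-sym : ∀ ⋆ → Symmetric (Adjacent ⋆)
    adjacent-sym strong (inj₁ (e , q))        = inj₁ (G.∼-sym e , sym q)
    adjacent-sym strong (inj₂ (inj₁ (q , f))) = inj₂ (inj₁ (sym q , H.∼-sym f))
    adjacent-sym strong (inj₂ (inj₂ (e , f))) = inj₂ (inj₂ (G.∼-sym e , H.∼-sym f))
    adjacent-sym lexicographic (inj₁ e)       = inj₁ (G.∼-sym e)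
    adjacent-sym lexicographic (inj₂ (q , f)) = inj₂ (sym q , H.∼-sym f)

    adjacent-irrefl : ∀ ⋆ {v} → ¬ Adjacent ⋆ v v
    adjacent-irrefl strong (inj₁ (e , _))        = G.∼-irrefl e
    adjacent-irrefl strong (inj₂ (inj₁ (_ , f))) = H.∼-irrefl f
    adjacent-irrefl strong (inj₂ (inj₂ (e , _))) = G.∼-irrefl e
    adjacent-irrefl lexicographic (inj₁ e)       = G.∼-irrefl e
    adjacent-irrefl lexicographic (inj₂ (_ , f)) = H.∼-irrefl f

  productGraph : Product → Graph
  productGraph ⋆ = record
    { Vertex   = Vertex G × Vertex H
    ; order    = G.order * H.order
    ; finite   = ↔-trans (G.finite ×-↔ H.finite) (↔-sym *↔×)
    ; nonEmpty = m*n≢0 G.order H.order {{G.nonEmpty}} {{H.nonEmpty}}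
    ; _∼_      = Adjacent ⋆
    ; _∼?_     = adjacent? ⋆
    ; ∼-sym    = adjacent-sym ⋆
    ; ∼-irrefl = adjacent-irrefl ⋆
    }

_⟪_⟫_ : Graph → Product → Graph → Graph
G ⟪ ⋆ ⟫ H = productGraph G H ⋆

module _ {G H : Graph} (MG : EdgeSet G) (MH : EdgeSet H) where
  private
    module G = Graph G
    module H = Graph H
    module MG = EdgeSet MG
    module MH = EdgeSet MH

  F∗ : Rel (Vertex G × Vertex H) 0ℓ
  F∗ (g , h) (g′ , h′) = MG.joins g g′ × MH.joins h h′

  Mᵁ-G : Rel (Vertex G × Vertex H) 0ℓ
  Mᵁ-G (g , h) (g′ , h′) = Unmatched MG g × g ≡ g′ × MH.joins h h′

  Mᵁ-H : Rel (Vertex G × Vertex H) 0ℓ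
  Mᵁ-H (g , h) (g′ , h′) = Unmatched MH h × h ≡ h′ × MG.joins g g′

  F⊛-joins : Rel (Vertex G × Vertex H) 0ℓ
  F⊛-joins p q = F∗ p q ⊎ Mᵁ-G p q ⊎ Mᵁ-H p q

  private
    F⊛-joins? : Decidable F⊛-joins
    F⊛-joins? (g , h) (g′ , h′) =
      (MG.joins? g g′ ×-dec MH.joins? h h′) ⊎-dec
      ((unmatched? MG g ×-dec ((g G.≟ᵥ g′) ×-dec MH.joins? h h′)) ⊎-dec
       (unmatched? MH h ×-dec ((h H.≟ᵥ h′) ×-dec MG.joins? g g′)))

    F⊛-sym : Symmetric F⊛-joins
    F⊛-sym (inj₁ (e , f))                = inj₁ (MG.joins-sym e , MH.joins-sym f)
    F⊛-sym (inj₂ (inj₁ (w , refl , f))) = inj₂ (inj₁ (w , refl , MH.joins-sym f))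
    F⊛-sym (inj₂ (inj₂ (w , refl , e))) = inj₂ (inj₂ (w , refl , MG.joins-sym e))

    F⊛⊆E : ∀ ⋆ {p q} → F⊛-joins p q → Adjacent G H ⋆ p q
    F⊛⊆E strong (inj₁ (e , f))                    = inj₂ (inj₂ (MG.⊆E e , MH.⊆E f))
    F⊛⊆E strong (inj₂ (inj₁ (_ , q , f)))         = inj₂ (inj₁ (q , MH.⊆E f))
    F⊛⊆E strong (inj₂ (inj₂ (_ , q , e)))         = inj₁ (MG.⊆E e , q)
    F⊛⊆E lexicographic (inj₁ (e , _))             = inj₁ (MG.⊆E e)
    F⊛⊆E lexicographic (inj₂ (inj₁ (_ , q , f)))  = inj₂ (q , MH.⊆E f)
    F⊛⊆E lexicographic (inj₂ (inj₂ (_ , _ , e)))  = inj₁ (MG.⊆E e)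

  F⊛ : ∀ ⋆ → EdgeSet (G ⟪ ⋆ ⟫ H)
  F⊛ ⋆ = record
    { joins     = F⊛-joins
    ; joins?    = F⊛-joins?
    ; joins-sym = F⊛-sym
    ; ⊆E        = F⊛⊆E ⋆
    }

WellBehaved : Product → ℕ → Graph → Graph → Set₁
WellBehaved ⋆ k G H =
  Σ[ MG ∈ EdgeSet G ] Σ[ MH ∈ EdgeSet H ]
    IsMatching k (F⊛ MG MH ⋆) × matchingNumber k (G ⟪ ⋆ ⟫ H) ≡ size (F⊛ MG MH ⋆)

module _ (k : ℕ) {G H : Graph} (MG : EdgeSet G) (MH : EdgeSet H) where

  M1 : Set
  M1 = (IsPerfectMatching k MG × IsMatching 1 MH × NonEmpty MH)
     ⊎ (IsMatching k MG × NonEmpty MG × Empty MH)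

  M2 : Set
  M2 = (IsMatching 1 MG × NonEmpty MG × IsPerfectMatching k MH)
     ⊎ (Empty MG × IsMatching k MH × NonEmpty MH)

  M3 : Set
  M3 = k ≡ 1 × IsMatching 1 MG × IsMatching 1 MH

  M4 : Set
  M4 = ∃[ kG ] ∃[ kH ] 0 < kG × 0 < kH × kG * kH ≡ k
     × IsPerfectMatching kG MG × IsPerfectMatching kH MH

HasMatchingsM1-M4 : Product → ℕ → Graph → Graph → Set₁
HasMatchingsM1-M4 ⋆ k G H =
  Σ[ MG ∈ EdgeSet G ] Σ[ MH ∈ EdgeSet H ]
    (M1 k MG MH ⊎ M2 k MG MH ⊎ M3 k MG MH ⊎ M4 k MG MH)
    × unmatchedNumber k (G ⟪ ⋆ ⟫ H) ≡ unmatchedCount MG * unmatchedCount MH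

{-# OPTIONS --safe #-}
-- The degree of (g , h) in F⊛ is d(g) d(h) when both vertices are matched, and
-- d(g) + d(h) otherwise.  Hence (g , h) is unmatched iff g and h both are, so
-- F⊛ leaves exactly u_G u_H vertices unmatched, whatever M_G and M_H are.
-- For a k-matching, 2 |M| + k u = k |V|, so attaining the maximum size is the
-- same as attaining the unmatched number.  That F⊛ is a k-matching forces
-- constant degrees k_G and k_H on the matched vertices with k_G k_H = k, and an
-- unmatched vertex in G (in H) forces k_H = k (k_G = k); this yields M1-M4.
module Submission where

open import Data.Nat using (ℕ; zero; suc; _+_; _*_; _<_; z<s; s<s; NonZero; ≢-nonZero; >-nonZero)
open import Data.Nat.ListAction using (sum)
open import Data.Nat.Properties using (+-suc; *-suc; *-identityˡ; *-identityʳ; +-cancelˡ-≡; +-cancelʳ-≡; *-cancelˡ-≡; *-cancelʳ-≡; m*n≡0⇒m≡0∨n≡0; n≢0⇒n>0; n≮0; n>0⇒n≢0; <-cmp; <-asym; +-assoc)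
open import Data.Nat.Tactic.RingSolver using (solve-∀)
open import Data.Fin using (zero; toℕ)
open import Data.Fin.Properties using (toℕ-injective)
open import Data.List using (List; []; _∷_; _++_; length; filter; map; cartesianProduct)
open import Data.List.Properties using (filter-≐; filter-++; length-++; filter-none; filter-some)
open import Data.List.Membership.Propositional using (_∈_; lose)
open import Data.List.Membership.Propositional.Properties using (∈-map⁺; ∈-allFin; ∈-cartesianProduct⁺; ∈-filter⁺; ∈-filter⁻)
open import Data.List.Membership.Propositional.Properties.WithK using (unique∧set⇒bag)
open import Data.List.Relation.Binary.BagAndSetEquality using (∼bag⇒↭)
open import Data.List.Relation.Binary.Permutation.Propositional using (_↭_)
open import Data.List.Relation.Binary.Permutation.Propositional.Properties using (filter-↭; ↭-length)
open import Data.List.Relation.Unary.All as All using ([])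
open import Data.List.Relation.Unary.Any using (any?; here; satisfied)
open import Data.List.Relation.Unary.AllPairs using ([]; _∷_)
open import Data.List.Relation.Unary.Unique.Propositional using (Unique)
import Data.List.Relation.Unary.Unique.Propositional.Properties as Unique
open import Data.Product using (∃; _×_; _,_; proj₁; proj₂; swap; uncurry)
open import Data.Sum as Sum using (_⊎_; inj₁; inj₂)
open import Data.Empty using (⊥-elim)
open import Function using (_⇔_; mk⇔; _∘_; Injection; Inverse)
open import Function.Properties.Inverse using (↔⇒↣; ↔-sym)
open import Relation.Binary.Definitions using (tri<; tri≈; tri>)
open import Relation.Binary.PropositionalEquality using (_≡_; refl; sym; trans; cong; cong₂; subst; module ≡-Reasoning)
open import Relation.Nullary using (¬_; yes; no; contradiction)
open import Relation.Nullary.Decidable using (_×-dec_)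
open import Relation.Unary using (Decidable; _≐_)
open import Defs

private variable
  A B : Set

-- Counting in lists

count : {P : A → Set} → Decidable P → List A → ℕ
count P? xs = length (filter P? xs)

count-≐ : {P Q : A → Set} (P? : Decidable P) (Q? : Decidable Q) → P ≐ Q → ∀ xs → count P? xs ≡ count Q? xs
count-≐ P? Q? P≐Q xs = cong length (filter-≐ P? Q? P≐Q xs)

count-↭ : {P : A → Set} (P? : Decidable P) {xs ys : List A} → xs ↭ ys → count P? xs ≡ count P? ys
count-↭ P? xs↭ys = ↭-length (filter-↭ P? xs↭ys)

count-none : {P : A → Set} (P? : Decidable P) → (∀ x → ¬ P x) → ∀ xs → count P? xs ≡ 0
count-none P? ¬P xs = cong length (filter-none P? (All.universal ¬P xs))

count-map : {P : A → Set} (P? : Decidable P) (f : B → A) → ∀ xs → count P? (map f xs) ≡ count (P? ∘ f) xs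
count-map P? f []       = refl
count-map P? f (x ∷ xs) with P? (f x)
... | yes _ = cong suc (count-map P? f xs)
... | no  _ = count-map P? f xs

count-⊎ : {P Q R : A → Set} (P? : Decidable P) (Q? : Decidable Q) (R? : Decidable R) →
          (∀ x → R x → P x ⊎ Q x) → (∀ x → P x → R x) → (∀ x → Q x → R x) →
          (∀ x → P x → ¬ Q x) →
          ∀ xs → count R? xs ≡ count P? xs + count Q? xs
count-⊎ P? Q? R? R⇒P⊎Q P⇒R Q⇒R P⇒¬Q = go
  where
  go : ∀ xs → count R? xs ≡ count P? xs + count Q? xs
  go []       = refl
  go (x ∷ xs) with R? x | P? x | Q? x
  ... | yes r | yes p | yes q = contradiction q (P⇒¬Q x p)
  ... | yes r | yes p | no  _ = cong suc (go xs)
  ... | yes r | no  _ | yes q = trans (cong suc (go xs)) (sym (+-suc _ _))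
  ... | yes r | no ¬p | no ¬q = ⊥-elim (Sum.[ ¬p , ¬q ] (R⇒P⊎Q x r))
  ... | no ¬r | yes p | _     = contradiction (P⇒R x p) ¬r
  ... | no ¬r | no  _ | yes q = contradiction (Q⇒R x q) ¬r
  ... | no  _ | no  _ | no  _ = go xs

count-cartesianProduct : {P : A × B → Set} (P? : Decidable P) → ∀ xs ys →
  count P? (cartesianProduct xs ys) ≡ sum (map (λ x → count (λ y → P? (x , y)) ys) xs)
count-cartesianProduct P? []       ys = refl
count-cartesianProduct P? (x ∷ xs) ys = begin
  length (filter P? (map (x ,_) ys ++ cartesianProduct xs ys))
    ≡⟨ cong length (filter-++ P? (map (x ,_) ys) (cartesianProduct xs ys)) ⟩
  length (filter P? (map (x ,_) ys) ++ filter P? (cartesianProduct xs ys))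
    ≡⟨ length-++ (filter P? (map (x ,_) ys)) ⟩
  count P? (map (x ,_) ys) + count P? (cartesianProduct xs ys)
    ≡⟨ cong₂ _+_ (count-map P? (x ,_) ys) (count-cartesianProduct P? xs ys) ⟩
  count (λ y → P? (x , y)) ys + sum (map (λ x → count (λ y → P? (x , y)) ys) xs) ∎
  where open ≡-Reasoning

count-× : {P : A → Set} {Q : B → Set} (P? : Decidable P) (Q? : Decidable Q) → ∀ xs ys →
  count (λ (x , y) → P? x ×-dec Q? y) (cartesianProduct xs ys) ≡ count P? xs * count Q? ys
count-× P? Q? xs ys =
  trans (count-cartesianProduct (λ (x , y) → P? x ×-dec Q? y) xs ys) (go xs)
  where
  go : ∀ xs → sum (map (λ x → count (λ y → P? x ×-dec Q? y) ys) xs) ≡ count P? xs * count Q? ys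
  go []       = refl
  go (x ∷ xs) with P? x
  ... | yes p = cong₂ _+_ (count-≐ (λ y → yes p ×-dec Q? y) Q? (proj₂ , (p ,_)) ys) (go xs)
  ... | no ¬p = cong₂ _+_ (count-none (λ y → no ¬p ×-dec Q? y) (λ _ → ¬p ∘ proj₁) ys) (go xs)

-- Every entry adds exactly `k` to the left side: through `d` where `Z` fails, through the count
-- where it holds.
sum-two-valued : {Z : A → Set} (Z? : Decidable Z) (d : A → ℕ) (k : ℕ) →
  (∀ x → Z x → d x ≡ 0) → (∀ x → ¬ Z x → d x ≡ k) →
  ∀ xs → sum (map d xs) + k * count Z? xs ≡ k * length xs
sum-two-valued Z? d k d≡0 d≡k []       = refl
sum-two-valued Z? d k d≡0 d≡k (x ∷ xs) with ih ← sum-two-valued Z? d k d≡0 d≡k xs | Z? x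
... | yes z rewrite d≡0 x z =
  trans (exchange (sum (map d xs)) k (count Z? xs)) (trans (cong (k +_) ih) (sym (*-suc k (length xs))))
  where
  exchange : ∀ s k c → s + k * suc c ≡ k + (s + k * c)
  exchange = solve-∀
... | no ¬z rewrite d≡k x ¬z =
  trans (+-assoc k _ _) (trans (cong (k +_) ih) (sym (*-suc k (length xs))))

-- In lists without repetition, equal elements mean equal multiplicities. Counts thus carry over
-- between enumerations in different orders.
unique-sameElements⇒↭ : {xs ys : List A} → Unique xs → Unique ys →
  (∀ {x} → x ∈ xs → x ∈ ys) → (∀ {x} → x ∈ ys → x ∈ xs) → xs ↭ ys
unique-sameElements⇒↭ !xs !ys xs⊆ys ys⊆xs =
  ∼bag⇒↭ (unique∧set⇒bag !xs !ys (mk⇔ xs⊆ys ys⊆xs))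

-- The handshake lemma

module _ (G : Graph) where
  open Graph G

  vertex : Vertex
  vertex with order | nonEmpty | finite
  ... | suc _ | _ | fin = Inverse.from fin zero

  vertices-unique : Unique vertices
  vertices-unique = Unique.map⁺ (Injection.injective (↔⇒↣ (↔-sym finite))) (Unique.allFin⁺ order)

  ∈-vertices : ∀ v → v ∈ vertices
  ∈-vertices v = subst (_∈ vertices) (Inverse.strictlyInverseʳ finite v)
    (∈-map⁺ (Inverse.from finite) (∈-allFin (index v)))

  index-injective : ∀ {u v} → index u ≡ index v → u ≡ v
  index-injective = Injection.injective (↔⇒↣ finite)

  -- The enumeration is complete and repetition-free, so filtering leaves a permutation of `v ∷ []`.
  -- This gives the factor 1 in the degrees of vertices with an unmatched coordinate.
  count-≡ : ∀ v → count (v ≟ᵥ_) vertices ≡ 1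
  count-≡ v = ↭-length (unique-sameElements⇒↭
    (Unique.filter⁺ (v ≟ᵥ_) vertices-unique) ([] ∷ [])
    (λ u∈ → here (sym (proj₂ (∈-filter⁻ (v ≟ᵥ_) {xs = vertices} u∈))))
    (λ { (here refl) → ∈-filter⁺ (v ≟ᵥ_) (∈-vertices v) refl }))

  swap-vertices : map swap (cartesianProduct vertices vertices) ↭ cartesianProduct vertices vertices
  swap-vertices = unique-sameElements⇒↭
    (Unique.map⁺ (cong swap) !vv) !vv (λ _ → ∈-vv _) (λ _ → ∈-map⁺ swap (∈-vv _))
    where
    !vv : Unique (cartesianProduct vertices vertices)
    !vv = Unique.cartesianProduct⁺ vertices-unique vertices-unique

    ∈-vv : ∀ p → p ∈ cartesianProduct vertices vertices
    ∈-vv (u , v) = ∈-cartesianProduct⁺ (∈-vertices u) (∈-vertices v)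

module _ {G : Graph} (M : EdgeSet G) where
  open Graph G
  open EdgeSet M

  -- Both sides count the ordered pairs joined by `M`: by first vertex, or split into those with
  -- increasing and those with decreasing index, which reversal puts in bijection.
  handshake : sum (map (degree M) vertices) ≡ size M + size M
  handshake = begin
    sum (map (degree M) vertices)
      ≡⟨ count-cartesianProduct (uncurry joins?) vertices vertices ⟨
    count (uncurry joins?) vv
      ≡⟨ count-⊎ (listed? M) (listed? M ∘ swap) (uncurry joins?)
           orient (λ _ → proj₂) (λ _ → joins-sym ∘ proj₂)
           (λ _ (i<j , _) (j<i , _) → <-asym i<j j<i) vv ⟩
    size M + count (listed? M ∘ swap) vv
      ≡⟨ cong (size M +_) (trans (sym (count-map (listed? M) swap vv))
           (count-↭ (listed? M) (swap-vertices G))) ⟩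
    size M + size M ∎
    where
    open ≡-Reasoning
    vv = cartesianProduct vertices vertices

    orient : ∀ p → uncurry joins p → Listed M p ⊎ Listed M (swap p)
    orient (u , v) e with <-cmp (toℕ (index u)) (toℕ (index v))
    ... | tri< i<j _ _ = inj₁ (i<j , e)
    ... | tri> _ _ j<i = inj₂ (j<i , joins-sym e)
    -- Equal indices would make the edge a loop.
    ... | tri≈ _ i≡j _ with refl ← index-injective G (toℕ-injective i≡j) =
      contradiction (⊆E e) ∼-irrefl

  matched⇒degree≡ : ∀ {k} → IsMatching k M → ∀ v → ¬ Unmatched M v → degree M v ≡ k
  matched⇒degree≡ isM v m = Sum.fromInj₂ (λ u → contradiction u m) (isM v)

  -- The handshake identity for degrees 0 and `k`, kept free of subtraction so that cancellation in
  -- `ℕ` suffices later.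
  matching-handshake : ∀ {k} → IsMatching k M →
    size M + size M + k * unmatchedCount M ≡ k * length vertices
  matching-handshake {k} isM = trans
    (cong (_+ k * unmatchedCount M) (sym handshake))
    (sum-two-valued (unmatched? M) (degree M) k (λ _ d≡0 → d≡0) (matched⇒degree≡ isM) vertices)

  joins⇒matched : ∀ {u v} → joins u v → ¬ Unmatched M u
  joins⇒matched {u} {v} e = n>0⇒n≢0 (filter-some (joins? u) (lose (∈-vertices G v) e))

  empty⇒unmatched : Empty M → ∀ v → Unmatched M v
  empty⇒unmatched ∅M v = count-none (joins? v) (∅M v) vertices

  empty⇒size≡0 : Empty M → size M ≡ 0
  empty⇒size≡0 ∅M = count-none (listed? M) (λ (u , v) → ∅M u v ∘ proj₂) (cartesianProduct vertices vertices)

  nonEmpty⊎empty : NonEmpty M ⊎ Empty M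
  nonEmpty⊎empty with any? (uncurry joins?) (cartesianProduct vertices vertices)
  ... | yes some with (u , v) , e ← satisfied some = inj₁ (u , v , e)
  ... | no  none = inj₂ λ u v e →
    none (lose (∈-cartesianProduct⁺ (∈-vertices G u) (∈-vertices G v)) e)

  unmatched⊎perfect : ∃ (Unmatched M) ⊎ (∀ v → ¬ Unmatched M v)
  unmatched⊎perfect with any? (unmatched? M) vertices
  ... | yes some = inj₁ (satisfied some)
  ... | no  none = inj₂ λ v d≡0 → none (lose (∈-vertices G v) d≡0)

module _ {G : Graph} {k : ℕ} (M N : EdgeSet G) (isM : IsMatching k M) (isN : IsMatching k N) where
  private
    2size+ku : size M + size M + k * unmatchedCount M ≡ size N + size N + k * unmatchedCount N
    2size+ku = trans (matching-handshake M isM) (sym (matching-handshake N isN))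

    double : ∀ s → s + s ≡ 2 * s
    double = solve-∀

  -- Both matchings satisfy the identity with the same right side, so equal sizes leave equal
  -- multiples of `k`, and a positive `k` cancels.
  size≡⇒unmatchedCount≡ : .{{NonZero k}} → size M ≡ size N → unmatchedCount M ≡ unmatchedCount N
  size≡⇒unmatchedCount≡ s≡ = *-cancelˡ-≡ _ _ k
    (+-cancelˡ-≡ (size N + size N) _ _
      (trans (cong (λ s → s + s + k * unmatchedCount M) (sym s≡)) 2size+ku))

  -- The same identity read the other way: the unmatched terms cancel, leaving twice the sizes.
  unmatchedCount≡⇒size≡ : unmatchedCount M ≡ unmatchedCount N → size M ≡ size N
  unmatchedCount≡⇒size≡ u≡ = *-cancelˡ-≡ _ _ 2
    (trans (sym (double (size M))) (trans
      (+-cancelʳ-≡ (k * unmatchedCount N) _ _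
        (trans (cong (λ u → size M + size M + k * u) (sym u≡)) 2size+ku))
      (double (size N))))

-- Degrees and unmatched vertices of F⊛

module _ (⋆ : Product) {G H : Graph} (MG : EdgeSet G) (MH : EdgeSet H) where
  private
    module G = Graph G
    module H = Graph H
    module MG = EdgeSet MG
    module MH = EdgeSet MH
    module GH = Graph (G ⟪ ⋆ ⟫ H)

    F : EdgeSet (G ⟪ ⋆ ⟫ H)
    F = F⊛ MG MH ⋆

  vertices-product : GH.vertices ↭ cartesianProduct G.vertices H.vertices
  vertices-product = unique-sameElements⇒↭
    (vertices-unique (G ⟪ ⋆ ⟫ H))
    (Unique.cartesianProduct⁺ (vertices-unique G) (vertices-unique H))
    (λ {(g , h)} _ → ∈-cartesianProduct⁺ (∈-vertices G g) (∈-vertices H h))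
    (λ _ → ∈-vertices (G ⟪ ⋆ ⟫ H) _)

  -- Used for rectangles: the neighbourhood of any vertex in `F⊛`, and the set of vertices that `F⊛`
  -- leaves unmatched.
  count-product : {P : G.Vertex → Set} {Q : H.Vertex → Set} {R : G.Vertex × H.Vertex → Set}
    (P? : Decidable P) (Q? : Decidable Q) (R? : Decidable R) →
    (R ≐ λ (g , h) → P g × Q h) →
    count R? GH.vertices ≡ count P? G.vertices * count Q? H.vertices
  count-product P? Q? R? R≐P×Q = begin
    count R? GH.vertices
      ≡⟨ count-≐ R? (λ (g , h) → P? g ×-dec Q? h) R≐P×Q GH.vertices ⟩
    count (λ (g , h) → P? g ×-dec Q? h) GH.vertices
      ≡⟨ count-↭ (λ (g , h) → P? g ×-dec Q? h) vertices-product ⟩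
    count (λ (g , h) → P? g ×-dec Q? h) (cartesianProduct G.vertices H.vertices)
      ≡⟨ count-× P? Q? G.vertices H.vertices ⟩
    count P? G.vertices * count Q? H.vertices ∎
    where open ≡-Reasoning

  -- `Mᵁ-G` and `Mᵁ-H` need an unmatched coordinate, so only `F∗` reaches this vertex.
  degree-F⊛-matched : ∀ g h → ¬ Unmatched MG g → ¬ Unmatched MH h →
    degree F (g , h) ≡ degree MG g * degree MH h
  degree-F⊛-matched g h mg mh =
    count-product (MG.joins? g) (MH.joins? h) (EdgeSet.joins? F (g , h))
      ( (λ { (inj₁ e)                → e
           ; (inj₂ (inj₁ (ug , _))) → contradiction ug mg
           ; (inj₂ (inj₂ (uh , _))) → contradiction uh mh })
      , inj₁)

  -- No edge of `MG` meets `g`, which rules out `F∗` and `Mᵁ-H`; what remains is the copy of `MH` in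
  -- the fibre over `g`.
  degree-F⊛-unmatchedˡ : ∀ g h → Unmatched MG g → degree F (g , h) ≡ degree MH h
  degree-F⊛-unmatchedˡ g h ug = begin
    degree F (g , h)
      ≡⟨ count-product (g G.≟ᵥ_) (MH.joins? h) (EdgeSet.joins? F (g , h))
           ( (λ { (inj₁ (e , _))             → contradiction ug (joins⇒matched MG e)
                ; (inj₂ (inj₁ (_ , e)))      → e
                ; (inj₂ (inj₂ (_ , _ , e))) → contradiction ug (joins⇒matched MG e) })
           , (λ e → inj₂ (inj₁ (ug , e)))) ⟩
    count (g G.≟ᵥ_) G.vertices * degree MH h ≡⟨ cong (_* degree MH h) (count-≡ G g) ⟩
    1 * degree MH h                          ≡⟨ *-identityˡ (degree MH h) ⟩
    degree MH h                              ∎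
    where open ≡-Reasoning

  degree-F⊛-unmatchedʳ : ∀ g h → Unmatched MH h → degree F (g , h) ≡ degree MG g
  degree-F⊛-unmatchedʳ g h uh = begin
    degree F (g , h)
      ≡⟨ count-product (MG.joins? g) (h H.≟ᵥ_) (EdgeSet.joins? F (g , h))
           ( (λ { (inj₁ (_ , e))             → contradiction uh (joins⇒matched MH e)
                ; (inj₂ (inj₁ (_ , _ , e))) → contradiction uh (joins⇒matched MH e)
                ; (inj₂ (inj₂ (_ , e)))      → swap e })
           , (λ e → inj₂ (inj₂ (uh , swap e)))) ⟩
    degree MG g * count (h H.≟ᵥ_) H.vertices ≡⟨ cong (degree MG g *_) (count-≡ H h) ⟩
    degree MG g * 1                          ≡⟨ *-identityʳ (degree MG g) ⟩
    degree MG g                              ∎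
    where open ≡-Reasoning

  unmatched-F⊛⁺ : ∀ {g h} → Unmatched MG g → Unmatched MH h → Unmatched F (g , h)
  unmatched-F⊛⁺ {g} {h} ug uh = trans (degree-F⊛-unmatchedˡ g h ug) uh

  unmatched-F⊛⁻ : ∀ {g h} → Unmatched F (g , h) → Unmatched MG g × Unmatched MH h
  unmatched-F⊛⁻ {g} {h} u with unmatched? MG g | unmatched? MH h
  ... | yes ug | _      = ug , trans (sym (degree-F⊛-unmatchedˡ g h ug)) u
  ... | no  _  | yes uh = trans (sym (degree-F⊛-unmatchedʳ g h uh)) u , uh
  -- Here the degree is a product of two nonzero factors, so it cannot vanish.
  ... | no  mg | no  mh = ⊥-elim (Sum.[ mg , mh ]
    (m*n≡0⇒m≡0∨n≡0 (degree MG g) (trans (sym (degree-F⊛-matched g h mg mh)) u)))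

  unmatchedCount-F⊛ : unmatchedCount F ≡ unmatchedCount MG * unmatchedCount MH
  unmatchedCount-F⊛ = count-product (unmatched? MG) (unmatched? MH) (unmatched? F)
    (unmatched-F⊛⁻ , uncurry unmatched-F⊛⁺)

  -- When `F⊛` is a `k`-matching

  module _ {k : ℕ} where

    -- One hypothesis for each degree formula. The last two are conditional because a copy of one
    -- edge set appears only over unmatched vertices of the other.
    F⊛-isMatching⁺ :
      (∀ g h → ¬ Unmatched MG g → ¬ Unmatched MH h → degree MG g * degree MH h ≡ k) →
      (∃ (Unmatched MG) → IsMatching k MH) →
      (∃ (Unmatched MH) → IsMatching k MG) →
      IsMatching k F
    F⊛-isMatching⁺ both onlyH onlyG (g , h) with unmatched? MG g | unmatched? MH h
    ... | yes ug | _      = subst (λ d → d ≡ 0 ⊎ d ≡ k) (sym (degree-F⊛-unmatchedˡ g h ug)) (onlyH (g , ug) h)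
    ... | no  _  | yes uh = subst (λ d → d ≡ 0 ⊎ d ≡ k) (sym (degree-F⊛-unmatchedʳ g h uh)) (onlyG (h , uh) g)
    ... | no  mg | no  mh = inj₂ (trans (degree-F⊛-matched g h mg mh) (both g h mg mh))

    module _ (isF : IsMatching k F) where

      degree-matched⁻ : ∀ g h → ¬ Unmatched MG g → ¬ Unmatched MH h → degree MG g * degree MH h ≡ k
      degree-matched⁻ g h mg mh with isF (g , h)
      ... | inj₁ u   = contradiction (proj₁ (unmatched-F⊛⁻ u)) mg
      ... | inj₂ d≡k = trans (sym (degree-F⊛-matched g h mg mh)) d≡k

      unmatchedˡ⇒isMatchingʳ : ∃ (Unmatched MG) → IsMatching k MH
      unmatchedˡ⇒isMatchingʳ (g , ug) h = subst (λ d → d ≡ 0 ⊎ d ≡ k) (degree-F⊛-unmatchedˡ g h ug) (isF (g , h))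

      unmatchedʳ⇒isMatchingˡ : ∃ (Unmatched MH) → IsMatching k MG
      unmatchedʳ⇒isMatchingˡ (h , uh) g = subst (λ d → d ≡ 0 ⊎ d ≡ k) (degree-F⊛-unmatchedʳ g h uh) (isF (g , h))

      module _ {g₀ : G.Vertex} {h₀ : H.Vertex} (mg₀ : ¬ Unmatched MG g₀) (mh₀ : ¬ Unmatched MH h₀) where

        -- With `h₀` fixed, every matched `g` gives the same product `degree MG g * degree MH h₀`,
        -- namely `k`; the nonzero second factor cancels.
        isMatchingˡ : IsMatching (degree MG g₀) MG
        isMatchingˡ g with unmatched? MG g
        ... | yes ug = inj₁ ug
        ... | no  mg = inj₂ (*-cancelʳ-≡ _ _ (degree MH h₀) {{≢-nonZero mh₀}}
          (trans (degree-matched⁻ g h₀ mg mh₀) (sym (degree-matched⁻ g₀ h₀ mg₀ mh₀))))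

        isMatchingʳ : IsMatching (degree MH h₀) MH
        isMatchingʳ h with unmatched? MH h
        ... | yes uh = inj₁ uh
        ... | no  mh = inj₂ (*-cancelˡ-≡ _ _ (degree MG g₀) {{≢-nonZero mg₀}}
          (trans (degree-matched⁻ g₀ h mg₀ mh) (sym (degree-matched⁻ g₀ h₀ mg₀ mh₀))))

-- The conditions M1-M4

module _ (⋆ : Product) {k : ℕ} {G H : Graph} (MG : EdgeSet G) (MH : EdgeSet H) where

  M1-M4 : Set
  M1-M4 = M1 k MG MH ⊎ M2 k MG MH ⊎ M3 k MG MH ⊎ M4 k MG MH

  private
    product : ∀ kG kH → kG * kH ≡ k → IsMatching kG MG → IsMatching kH MH →
      ∀ g h → ¬ Unmatched MG g → ¬ Unmatched MH h → degree MG g * degree MH h ≡ k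
    product kG kH eq isG isH g h mg mh =
      trans (cong₂ _*_ (matched⇒degree≡ MG isG g mg) (matched⇒degree≡ MH isH h mh)) eq

  -- Matched degrees are constant with product `k`, or one edge set is empty and no such pair
  -- occurs. A perfect factor has no unmatched vertex, so the requirement that such a vertex would
  -- trigger is vacuous.
  M1-M4⇒F⊛-isMatching : M1-M4 → IsMatching k (F⊛ MG MH ⋆)
  M1-M4⇒F⊛-isMatching (inj₁ (inj₁ ((isG , perfG) , isH , _))) =
    F⊛-isMatching⁺ ⋆ MG MH (product k 1 (*-identityʳ k) isG isH)
      (λ (g , ug) → contradiction ug (perfG g)) (λ _ → isG)
  M1-M4⇒F⊛-isMatching (inj₁ (inj₂ (isG , _ , ∅H))) =
    F⊛-isMatching⁺ ⋆ MG MH (λ _ h _ mh → contradiction (empty⇒unmatched MH ∅H h) mh)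
      (λ _ h → inj₁ (empty⇒unmatched MH ∅H h)) (λ _ → isG)
  M1-M4⇒F⊛-isMatching (inj₂ (inj₁ (inj₁ (isG , _ , isH , perfH)))) =
    F⊛-isMatching⁺ ⋆ MG MH (product 1 k (*-identityˡ k) isG isH)
      (λ _ → isH) (λ (h , uh) → contradiction uh (perfH h))
  M1-M4⇒F⊛-isMatching (inj₂ (inj₁ (inj₂ (∅G , isH , _)))) =
    F⊛-isMatching⁺ ⋆ MG MH (λ g _ mg _ → contradiction (empty⇒unmatched MG ∅G g) mg)
      (λ _ → isH) (λ _ g → inj₁ (empty⇒unmatched MG ∅G g))
  M1-M4⇒F⊛-isMatching (inj₂ (inj₂ (inj₁ (refl , isG , isH)))) =
    F⊛-isMatching⁺ ⋆ MG MH (product 1 1 refl isG isH) (λ _ → isH) (λ _ → isG)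
  M1-M4⇒F⊛-isMatching (inj₂ (inj₂ (inj₂ (kG , kH , _ , _ , eq , (isG , perfG) , (isH , perfH))))) =
    F⊛-isMatching⁺ ⋆ MG MH (product kG kH eq isG isH)
      (λ (g , ug) → contradiction ug (perfG g)) (λ (h , uh) → contradiction uh (perfH h))

  module _ (0<k : 0 < k) (isF : IsMatching k (F⊛ MG MH ⋆)) where
    private
      instance
        k≢0 : NonZero k
        k≢0 = >-nonZero 0<k

    -- If exactly one edge set is empty, M1(b) or M2(b) holds; if both are, M3. If neither is, the
    -- outcome depends on which of them are perfect: both give M4, one gives M1(a) or M2(a), none
    -- gives M3.
    F⊛-isMatching⇒M1-M4 : (1 < k → 0 < size (F⊛ MG MH ⋆)) → M1-M4
    F⊛-isMatching⇒M1-M4 nontrivial with nonEmpty⊎empty MG | nonEmpty⊎empty MH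
    ... | inj₂ ∅G | inj₂ ∅H = inj₂ (inj₂ (inj₁
            (k≡1 0<k nontrivial , inj₁ ∘ empty⇒unmatched MG ∅G , inj₁ ∘ empty⇒unmatched MH ∅H)))
      where
      F-empty : Empty (F⊛ MG MH ⋆)
      F-empty _ _ (inj₁ (e , _))            = ∅G _ _ e
      F-empty _ _ (inj₂ (inj₁ (_ , _ , e))) = ∅H _ _ e
      F-empty _ _ (inj₂ (inj₂ (_ , _ , e))) = ∅G _ _ e

      k≡1 : ∀ {k} → 0 < k → (1 < k → 0 < size (F⊛ MG MH ⋆)) → k ≡ 1
      k≡1 {suc zero}    _ _  = refl
      -- From 2 on, `nontrivial` would give the empty `F⊛` a positive size.
      k≡1 {suc (suc _)} _ nt =
        contradiction (subst (0 <_) (empty⇒size≡0 (F⊛ MG MH ⋆) F-empty) (nt (s<s z<s))) n≮0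
    -- The empty `MG` leaves every vertex unmatched, so the fibre over any one of them exhibits `MH`
    -- as a `k`-matching.
    ... | inj₂ ∅G | inj₁ neH = inj₂ (inj₁ (inj₂
            (∅G , unmatchedˡ⇒isMatchingʳ ⋆ MG MH isF (vertex G , empty⇒unmatched MG ∅G _) , neH)))
    ... | inj₁ neG | inj₂ ∅H = inj₁ (inj₂
            (unmatchedʳ⇒isMatchingˡ ⋆ MG MH isF (vertex H , empty⇒unmatched MH ∅H _) , neG , ∅H))
    ... | inj₁ neG@(g , _ , eG) | inj₁ neH@(h , _ , eH) = cases (unmatched⊎perfect MG) (unmatched⊎perfect MH)
      where
      mg : ¬ Unmatched MG g
      mg = joins⇒matched MG eG

      mh : ¬ Unmatched MH h
      mh = joins⇒matched MH eH

      kG = degree MG g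
      kH = degree MH h

      kG*kH≡k : kG * kH ≡ k
      kG*kH≡k = degree-matched⁻ ⋆ MG MH isF g h mg mh

      isG : IsMatching kG MG
      isG = isMatchingˡ ⋆ MG MH isF mg mh

      isH : IsMatching kH MH
      isH = isMatchingʳ ⋆ MG MH isF mg mh

      -- An unmatched vertex of `G` makes `MH` a `k`-matching, so `kH` is `k` and `kG * k` equals
      -- `k`.
      unmatchedˡ⇒kG≡1 : ∃ (Unmatched MG) → kG ≡ 1
      unmatchedˡ⇒kG≡1 u = *-cancelʳ-≡ kG 1 k (trans
        (cong (kG *_) (sym (matched⇒degree≡ MH (unmatchedˡ⇒isMatchingʳ ⋆ MG MH isF u) h mh)))
        (trans kG*kH≡k (sym (*-identityˡ k))))

      unmatchedʳ⇒kH≡1 : ∃ (Unmatched MH) → kH ≡ 1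
      unmatchedʳ⇒kH≡1 u = *-cancelˡ-≡ kH 1 k (trans
        (cong (_* kH) (sym (matched⇒degree≡ MG (unmatchedʳ⇒isMatchingˡ ⋆ MG MH isF u) g mg)))
        (trans kG*kH≡k (sym (*-identityʳ k))))

      oneG : ∃ (Unmatched MG) → IsMatching 1 MG
      oneG u = subst (λ d → IsMatching d MG) (unmatchedˡ⇒kG≡1 u) isG

      oneH : ∃ (Unmatched MH) → IsMatching 1 MH
      oneH u = subst (λ d → IsMatching d MH) (unmatchedʳ⇒kH≡1 u) isH

      cases : ∃ (Unmatched MG) ⊎ (∀ v → ¬ Unmatched MG v) →
              ∃ (Unmatched MH) ⊎ (∀ v → ¬ Unmatched MH v) → M1-M4
      cases (inj₁ uG) (inj₁ uH) = inj₂ (inj₂ (inj₁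
        (trans (sym kG*kH≡k) (cong₂ _*_ (unmatchedˡ⇒kG≡1 uG) (unmatchedʳ⇒kH≡1 uH)) , oneG uG , oneH uH)))
      cases (inj₁ uG) (inj₂ perfH) = inj₂ (inj₁ (inj₁
        (oneG uG , neG , unmatchedˡ⇒isMatchingʳ ⋆ MG MH isF uG , perfH)))
      cases (inj₂ perfG) (inj₁ uH) = inj₁ (inj₁
        ((unmatchedʳ⇒isMatchingˡ ⋆ MG MH isF uH , perfG) , oneH uH , neH))
      cases (inj₂ perfG) (inj₂ perfH) = inj₂ (inj₂ (inj₂
        (kG , kH , n≢0⇒n>0 mg , n≢0⇒n>0 mh , kG*kH≡k , (isG , perfG) , (isH , perfH))))

-- The second hypothesis excludes a degenerate case: if `k` exceeds 1 and the product has only the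
-- empty `k`-matching, two empty edge sets witness the first statement, while the second would force
-- both edge sets to be empty, which no condition then allows.
mainTheorem12 : (⋆ : Product) (k : ℕ) (G H : Graph) →
    0 < k →
    (1 < k → 0 < matchingNumber k (G ⟪ ⋆ ⟫ H)) →
    WellBehaved ⋆ k G H ⇔ HasMatchingsM1-M4 ⋆ k G H
mainTheorem12 ⋆ k G H 0<k nontrivial = mk⇔
  (λ (MG , MH , isF , m≡size) →
    MG , MH ,
    F⊛-isMatching⇒M1-M4 ⋆ MG MH 0<k isF (subst (0 <_) m≡size ∘ nontrivial) ,
    trans (size≡⇒unmatchedCount≡ max (F⊛ MG MH ⋆) isMax isF {{>-nonZero 0<k}} m≡size)
          (unmatchedCount-F⊛ ⋆ MG MH))
  (λ (MG , MH , conditions , u≡) →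
    let isF = M1-M4⇒F⊛-isMatching ⋆ MG MH conditions in
    MG , MH , isF ,
    unmatchedCount≡⇒size≡ max (F⊛ MG MH ⋆) isMax isF
      (trans u≡ (sym (unmatchedCount-F⊛ ⋆ MG MH))))
  where
  max : EdgeSet (G ⟪ ⋆ ⟫ H)
  max = proj₁ (maximumMatching k (G ⟪ ⋆ ⟫ H))

  isMax : IsMatching k max
  isMax = proj₁ (proj₂ (maximumMatching k (G ⟪ ⋆ ⟫ H)))
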